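{- $\pi(\vec T_3,5/3)=1$.
   Context: A partially directed $3$-graph ($3$-PDG) on a vertex set $V$ specifies for each $3$-subset $S\subseteq V$ exactly one of: no edge on $S$; an undirected edge on $S$; or a directed edge on $S$ directed toward a chosen vertex of $S$. For an $n$-vertex $3$-PDG $\vec H$, $\alpha(\vec H)=e_u(\vec H)/\binom n3$ and $\beta(\vec H)=e_d(\vec H)/\binom n3$, with $e_u,e_d$ the numbers of undirected and directed edges. $\vec F$ is a subgraph of $\vec H$ if a $3$-PDG isomorphic to $\vec F$ can be obtained from $\vec H$ by deleting edges, deleting vertices and forgetting directions of edges; $\vec H$ is $\vec F$-free otherwise. $\vec T_3$ is the $3$-PDG on $\{1,2,3,4\}$ with undirected edges $\{1,2,3\}$, $\{2,3,4\}$ and the edge $\{1,2,4\}$ directed toward $4$. $\pi(\vec F,\theta)$ is the smallest real number such that every $n$-vertex $\vec F$-free $3$-PDG $\vec H$ satisfies $\alpha(\vec H)+\theta\beta(\vec H)\le\pi(\vec F,\theta)+o_{n\to\infty}(1)$. -}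

module Defs where

open import Data.Nat using (ℕ; zero; suc; _+_; _*_; _≤_)
open import Data.Nat.Combinatorics using (_C_)
open import Data.Fin using (Fin; _<_; _<?_) renaming (zero to f0; suc to fs)
open import Data.List using (List; map; allFin)
open import Data.Nat.ListAction using (sum)
open import Data.Bool using (Bool; true; false; _∧_; if_then_else_)
open import Data.Product using (Σ; ∃; _×_; _,_)
open import Data.Sum using (_⊎_)
open import Relation.Nullary using (¬_)
open import Relation.Nullary.Decidable using (⌊_⌋)
open import Relation.Binary.PropositionalEquality using (_≡_; _≢_)
open import Function.Definitions using (Injective)

-- The label of a 3-subset: no edge, an undirected edge, or an edge directed
-- toward a vertex v (which must lie in the 3-subset).
data Label (n : ℕ) : Set where
  none  : Label n
  undir : Label n
  dir   : Fin n → Label n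

record PDG (n : ℕ) : Set where
  field
    edge    : Fin n → Fin n → Fin n → Label n
    swap₁₂  : ∀ x y z → edge x y z ≡ edge y x z
    swap₂₃  : ∀ x y z → edge x y z ≡ edge x z y
    degen   : ∀ x z → edge x x z ≡ none
    dirIn   : ∀ x y z v → edge x y z ≡ dir v → v ≡ x ⊎ v ≡ y ⊎ v ≡ z
open PDG public

isUndir : ∀ {n} → Label n → Bool
isUndir undir = true
isUndir _     = false

isDir : ∀ {n} → Label n → Bool
isDir (dir _) = true
isDir _       = false

count3 : ∀ {n} → (Fin n → Fin n → Fin n → Bool) → ℕ
count3 {n} P =
  sum (map (λ x → sum (map (λ y → sum (map (λ z →
    if ⌊ x <? y ⌋ ∧ ⌊ y <? z ⌋ ∧ P x y z then 1 else 0)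
    (allFin n))) (allFin n))) (allFin n))

eU : ∀ {n} → PDG n → ℕ
eU H = count3 (λ x y z → isUndir (edge H x y z))

eD : ∀ {n} → PDG n → ℕ
eD H = count3 (λ x y z → isDir (edge H x y z))

-- T⃗₃ on vertices 0,1,2,3 (paper's 1,2,3,4): undirected {0,1,2}, {1,2,3};
-- {0,1,3} directed toward 3.  T⃗₃ ⊆ H iff there is an injective vertex map f
-- such that undirected edges of T⃗₃ map to edges of H (of either kind,
-- since directions may be forgotten) and the directed edge maps to an edge
-- of H directed toward f 3.
containsT3 : ∀ {n} → PDG n → Set
containsT3 {n} H =
  Σ (Fin 4 → Fin n) λ f →
    Injective _≡_ _≡_ f
    × edge H (f f0) (f (fs f0)) (f (fs (fs f0))) ≢ none
    × edge H (f (fs f0)) (f (fs (fs f0))) (f (fs (fs (fs f0)))) ≢ none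
    × edge H (f f0) (f (fs f0)) (f (fs (fs (fs f0)))) ≡ dir (f (fs (fs (fs f0))))

T3Free : ∀ {n} → PDG n → Set
T3Free H = ¬ containsT3 H

{-# OPTIONS --safe #-}

-- Give an undirected edge weight 3 and a directed edge weight 5.  In a T⃗₃-free
-- 3-PDG the ten triples on any five vertices have total weight at most
-- 30 = 3 · C(5,3): six or fewer edges weigh at most 30 anyway, and with seven or more
-- edges the few missing triples leave room for few directed edges, because each
-- of the two 4-sets containing a directed edge must miss the triple formed by
-- its tail and the fourth vertex, or else both other triples.  Averaging over all
-- 5-tuples of vertices gives the upper bound; tuples with repetitions need no
-- separate treatment, since degenerate triples are not edges.  The complete undirected 3-graph
-- gives the lower bound.
module Submission where

open import Defs
open import Data.Bool using (Bool; true; false; _∧_; _∨_; not; if_then_else_; T)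
open import Data.Bool.Properties using (T-∧; ∧-zeroʳ)
open import Data.Empty using (⊥; ⊥-elim)
open import Data.Fin using (Fin; _<?_; _≟_; zero; suc)
import Data.Fin.Properties as Fin
open import Data.List using (List; []; _∷_; map; allFin; length)
open import Data.List.Properties using (length-tabulate; map-tabulate)
open import Data.Nat using (ℕ; zero; suc; _+_; _*_; _≤_; _≤ᵇ_; z≤n; s≤s)
open import Data.Nat.Combinatorics using (_C_; nC1≡n; nCk+nC[k+1]≡[n+1]C[k+1])
open import Data.Nat.ListAction using (sum)
open import Data.Nat.Properties hiding (_≟_; _<?_)
open import Data.Nat.Tactic.RingSolver using (solve-∀)
open import Data.Product using (Σ; _×_; _,_; proj₁; proj₂)
open import Data.Sum using (_⊎_; inj₁; inj₂)
open import Data.Unit using (tt)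
open import Data.Vec using (Vec; []; _∷_)
open import Function using (_∘_)
open import Function.Bundles using (Equivalence; mk⇔)
open import Relation.Binary.PropositionalEquality using (_≡_; _≢_; refl; sym; trans; cong; cong₂; subst; module ≡-Reasoning)
open import Relation.Nullary using (Dec; does; yes; no; ¬_; contradiction)
open import Relation.Nullary.Decidable using (⌊_⌋; isYes≗does; does-⇔; dec-true; dec-false; _⊎-dec_)

𝟙 : Bool → ℕ
𝟙 b = if b then 1 else 0

T-∧-intro : ∀ {a b} → T a → T b → T (a ∧ b)
T-∧-intro p q = Equivalence.from T-∧ (p , q)

-- Exhaustive checking of Boolean functions

allAssignments : ∀ n → (Vec Bool n → Bool) → Bool
allAssignments zero    f = f []
allAssignments (suc n) f =
  allAssignments n (λ v → f (true ∷ v)) ∧ allAssignments n (λ v → f (false ∷ v))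

-- The hypothesis is evaluated on all 2^n vectors, so `tt` proves it whenever the check succeeds.
-- Boolean inequalities thus reduce to computation.
allAssignments-sound : ∀ n (f : Vec Bool n → Bool) →
                       T (allAssignments n f) → ∀ v → T (f v)
allAssignments-sound zero    f t []          = t
allAssignments-sound (suc n) f t (true ∷ v)  =
  allAssignments-sound n _ (proj₁ (Equivalence.to T-∧ t)) v
allAssignments-sound (suc n) f t (false ∷ v) =
  allAssignments-sound n _ (proj₂ (Equivalence.to (T-∧ {allAssignments n _}) t)) v

-- Finite sums

module _ {A : Set} where

  sum-map-mono : ∀ {f g : A → ℕ} → (∀ x → f x ≤ g x) →
                 ∀ xs → sum (map f xs) ≤ sum (map g xs)
  sum-map-mono f≤g []       = z≤n
  sum-map-mono f≤g (x ∷ xs) = +-mono-≤ (f≤g x) (sum-map-mono f≤g xs)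

  sum-map-+ : ∀ (f g : A → ℕ) xs →
              sum (map (λ x → f x + g x) xs) ≡ sum (map f xs) + sum (map g xs)
  sum-map-+ f g []       = refl
  sum-map-+ f g (x ∷ xs) = trans (cong (f x + g x +_) (sum-map-+ f g xs))
    (interchange (f x) (g x) (sum (map f xs)) (sum (map g xs)))
    where
    interchange : ∀ a b c d → a + b + (c + d) ≡ a + c + (b + d)
    interchange = solve-∀

  sum-map-* : ∀ m (f : A → ℕ) xs →
              sum (map (λ x → m * f x) xs) ≡ m * sum (map f xs)
  sum-map-* m f []       = sym (*-zeroʳ m)
  sum-map-* m f (x ∷ xs) =
    trans (cong (m * f x +_) (sum-map-* m f xs)) (sym (*-distribˡ-+ m _ _))

  sum-map-const : ∀ c (xs : List A) → sum (map (λ _ → c) xs) ≡ length xs * c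
  sum-map-const c []       = refl
  sum-map-const c (x ∷ xs) = cong (c +_) (sum-map-const c xs)

sum-map-comm : ∀ {A B : Set} (f : A → B → ℕ) xs ys →
               sum (map (λ x → sum (map (f x) ys)) xs)
               ≡ sum (map (λ y → sum (map (λ x → f x y) xs)) ys)
sum-map-comm f []       ys = sym (trans (sum-map-const 0 ys) (*-zeroʳ (length ys)))
sum-map-comm f (x ∷ xs) ys =
  trans (cong (sum (map (f x) ys) +_) (sum-map-comm f xs ys))
        (sym (sum-map-+ (f x) (λ y → sum (map (λ x → f x y) xs)) ys))

-- multiple witnesses a ≡ m * b; unlike the equation, the type determines m and b.
data Multiple (m a b : ℕ) : Set where
  multiple : a ≡ m * b → Multiple m a b

multiple⁻¹ : ∀ {m a b} → Multiple m a b → a ≡ m * b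
multiple⁻¹ (multiple eq) = eq

-- The ten triples stand in lexicographic order, bracketed to the right so that sums and bounds can
-- be chained one triple at a time.
triplesSum : {A : Set} → (A → A → A → ℕ) → A → A → A → A → A → ℕ
triplesSum g a b c d e =
  g a b c + (g a b d + (g a b e + (g a c d + (g a c e +
  (g a d e + (g b c d + (g b c e + (g b d e + g c d e))))))))

module _ {n : ℕ} where

  ∑ : (Fin n → ℕ) → ℕ
  ∑ f = sum (map f (allFin n))

  ∑-mono : {f g : Fin n → ℕ} → (∀ x → f x ≤ g x) → ∑ f ≤ ∑ g
  ∑-mono f≤g = sum-map-mono f≤g (allFin n)

  ∑-cong : {f g : Fin n → ℕ} → (∀ x → f x ≡ g x) → ∑ f ≡ ∑ g
  ∑-cong f≡g = ≤-antisym (∑-mono (≤-reflexive ∘ f≡g)) (∑-mono (≤-reflexive ∘ sym ∘ f≡g))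

  ∑-comm : (f : Fin n → Fin n → ℕ) →
           ∑ (λ x → ∑ (λ y → f x y)) ≡ ∑ (λ y → ∑ (λ x → f x y))
  ∑-comm f = sum-map-comm f (allFin n) (allFin n)

  -- Computing iterated sums from the inside out: each variable either occurs
  -- in the summand or contributes a factor n.
  unit : ∀ {a} → Multiple 1 a a
  unit {a} = multiple (sym (*-identityˡ a))

  keep : ∀ {m} {f g : Fin n → ℕ} → (∀ x → Multiple m (f x) (g x)) → Multiple m (∑ f) (∑ g)
  keep {m} {g = g} eq =
    multiple (trans (∑-cong (multiple⁻¹ ∘ eq)) (sum-map-* m g (allFin n)))

  drop : ∀ {m a b} → Multiple m a b → Multiple (n * m) (∑ (λ _ → a)) b
  drop {m} {a} {b} (multiple refl) = multiple (begin
    ∑ (λ _ → m * b)               ≡⟨ sum-map-const (m * b) (allFin n) ⟩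
    length (allFin n) * (m * b)   ≡⟨ cong (_* (m * b)) (length-tabulate {n = n} (λ x → x)) ⟩
    n * (m * b)                   ≡⟨ sym (*-assoc n m b) ⟩
    n * m * b                     ∎)
    where open ≡-Reasoning

  ∑-split : {f g h : Fin n → ℕ} → (∀ x → f x ≡ g x + h x) → ∑ f ≡ ∑ g + ∑ h
  ∑-split {g = g} {h} eq = trans (∑-cong eq) (sum-map-+ g h (allFin n))

  ∑³ : (Fin n → Fin n → Fin n → ℕ) → ℕ
  ∑³ f = ∑ λ x → ∑ λ y → ∑ λ z → f x y z

  ∑³-mono : ∀ {f g} → (∀ x y z → f x y z ≤ g x y z) → ∑³ f ≤ ∑³ g
  ∑³-mono f≤g = ∑-mono λ x → ∑-mono λ y → ∑-mono λ z → f≤g x y z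

  ∑³-+ : ∀ f g → ∑³ (λ x y z → f x y z + g x y z) ≡ ∑³ f + ∑³ g
  ∑³-+ f g = ∑-split λ x → ∑-split λ y → ∑-split λ z → refl

  ∑³-* : ∀ m f → ∑³ (λ x y z → m * f x y z) ≡ m * ∑³ f
  ∑³-* m f = multiple⁻¹ (keep λ x → keep λ y → keep λ z → multiple {m} {b = f x y z} refl)

  ∑³-swap₁₂ : ∀ f → ∑³ (λ x y z → f y x z) ≡ ∑³ f
  ∑³-swap₁₂ f = ∑-comm (λ x y → ∑ λ z → f y x z)

  ∑³-swap₂₃ : ∀ f → ∑³ (λ x y z → f x z y) ≡ ∑³ f
  ∑³-swap₂₃ f = ∑-cong λ x → ∑-comm (λ y z → f x z y)

  ∑⁵ : (Fin n → Fin n → Fin n → Fin n → Fin n → ℕ) → ℕ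
  ∑⁵ f = ∑ λ a → ∑ λ b → ∑ λ c → ∑ λ d → ∑ λ e → f a b c d e

  ∑⁵-mono : ∀ {f g} → (∀ a b c d e → f a b c d e ≤ g a b c d e) → ∑⁵ f ≤ ∑⁵ g
  ∑⁵-mono f≤g = ∑-mono λ a → ∑-mono λ b → ∑-mono λ c → ∑-mono λ d → ∑-mono λ e →
    f≤g a b c d e

  ∑⁵-+ : ∀ f g → ∑⁵ (λ a b c d e → f a b c d e + g a b c d e) ≡ ∑⁵ f + ∑⁵ g
  ∑⁵-+ f g =
    ∑-split λ a → ∑-split λ b → ∑-split λ c → ∑-split λ d → ∑-split λ e → refl

  ∑⁵-const : ∀ c → ∑⁵ (λ _ _ _ _ _ → c) ≡ n * (n * (n * (n * (n * 1)))) * c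
  ∑⁵-const c = multiple⁻¹ (drop (drop (drop (drop (drop unit)))))

  -- Each triple uses three of the five summation variables, and the other two contribute a factor
  -- `n` each. The variables kept are already in the order of `∑³ g`, so every term is the same
  -- multiple of it.
  ∑⁵-triplesSum : (g : Fin n → Fin n → Fin n → ℕ) →
                  ∑⁵ (triplesSum g) ≡ 10 * (n * (n * 1) * ∑³ g)
  ∑⁵-triplesSum g = trans
    (add (λ a b c d e → g a b c) (keep λ a → keep λ b → keep λ c → drop (drop unit))
    (add (λ a b c d e → g a b d) (keep λ a → keep λ b → drop (keep λ d → drop unit))
    (add (λ a b c d e → g a b e) (keep λ a → keep λ b → drop (drop (keep λ e → unit)))
    (add (λ a b c d e → g a c d) (keep λ a → drop (keep λ c → keep λ d → drop unit))
    (add (λ a b c d e → g a c e) (keep λ a → drop (keep λ c → drop (keep λ e → unit)))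
    (add (λ a b c d e → g a d e) (keep λ a → drop (drop (keep λ d → keep λ e → unit)))
    (add (λ a b c d e → g b c d) (drop (keep λ b → keep λ c → keep λ d → drop unit))
    (add (λ a b c d e → g b c e) (drop (keep λ b → keep λ c → drop (keep λ e → unit)))
    (add (λ a b c d e → g b d e) (drop (keep λ b → drop (keep λ d → keep λ e → unit)))
         (multiple⁻¹ (drop (drop (keep λ c → keep λ d → keep λ e → unit)))))))))))))
    (tenfold (n * (n * 1) * ∑³ g))
    where
    add : ∀ f {h s} → Multiple (n * (n * 1)) (∑⁵ f) (∑³ g) → ∑⁵ h ≡ s →
          ∑⁵ (λ a b c d e → f a b c d e + h a b c d e) ≡ n * (n * 1) * ∑³ g + s
    add f {h} p q = trans (∑⁵-+ f h) (cong₂ _+_ (multiple⁻¹ p) q)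
    tenfold : ∀ s → s + (s + (s + (s + (s + (s + (s + (s + (s + s)))))))) ≡ 10 * s
    tenfold = solve-∀

-- Ordered and unordered triples

-- This and `decAcyclic` turn the order laws into Boolean axioms that the exhaustive check in
-- `sortedOnce` can assume.
decAsym : ∀ {P Q : Set} (p : Dec P) (q : Dec Q) → (P → ¬ Q) → T (not (⌊ p ⌋ ∧ ⌊ q ⌋))
decAsym (no _)  _       _ = tt
decAsym (yes p) (no _)  _ = tt
decAsym (yes p) (yes q) f = f p q

decAcyclic : ∀ {P Q R : Set} (p : Dec P) (q : Dec Q) (r : Dec R) →
             (P → Q → ¬ R) → T (not (⌊ p ⌋ ∧ ⌊ q ⌋ ∧ ⌊ r ⌋))
decAcyclic (no _)  _       _       _ = tt
decAcyclic (yes p) (no _)  _       _ = tt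
decAcyclic (yes p) (yes q) (no _)  _ = tt
decAcyclic (yes p) (yes q) (yes r) f = f p q r

T-∨-not : ∀ {a b} → T (not a ∨ b) → T a → T b
T-∨-not {true} t _ = t

module _ {n : ℕ} where

  -- At most one arrangement of three vertices is strictly increasing. Asymmetry and the absence of
  -- 3-cycles already force this, so the six comparisons and `P` may be treated as seven Booleans
  -- subject to those axioms.
  sortedOnce : ∀ P (x y z : Fin n) →
    let t = λ x y z → 𝟙 (⌊ x <? y ⌋ ∧ ⌊ y <? z ⌋ ∧ P) in
    t x y z + (t x z y + (t y x z + (t y z x + (t z x y + t z y x)))) ≤ 𝟙 P
  sortedOnce P x y z = ≤ᵇ⇒≤ _ _ (T-∨-not {ax (x<y ∷ y<x ∷ y<z ∷ z<y ∷ x<z ∷ z<x ∷ P ∷ [])}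
    (allAssignments-sound 7 (λ v → not (ax v) ∨ claim v) tt
      (x<y ∷ y<x ∷ y<z ∷ z<y ∷ x<z ∷ z<x ∷ P ∷ []))
    (T-∧-intro (decAsym (x <? y) (y <? x) Fin.<-asym)
    (T-∧-intro (decAsym (y <? z) (z <? y) Fin.<-asym)
    (T-∧-intro (decAsym (x <? z) (z <? x) Fin.<-asym)
    (T-∧-intro (decAcyclic (x <? y) (y <? z) (z <? x)
                 λ p q r → Fin.<-asym (Fin.<-trans p q) r)
               (decAcyclic (y <? x) (x <? z) (z <? y)
                 λ p q r → Fin.<-asym (Fin.<-trans p q) r))))))
    where
    x<y = ⌊ x <? y ⌋
    y<x = ⌊ y <? x ⌋
    y<z = ⌊ y <? z ⌋
    z<y = ⌊ z <? y ⌋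
    x<z = ⌊ x <? z ⌋
    z<x = ⌊ z <? x ⌋
    ax claim : Vec Bool 7 → Bool
    ax (xy ∷ yx ∷ yz ∷ zy ∷ xz ∷ zx ∷ p ∷ []) =
      not (xy ∧ yx) ∧ not (yz ∧ zy) ∧ not (xz ∧ zx)
      ∧ not (xy ∧ yz ∧ zx) ∧ not (yx ∧ xz ∧ zy)
    claim (xy ∷ yx ∷ yz ∷ zy ∷ xz ∷ zx ∷ p ∷ []) =
      𝟙 (xy ∧ yz ∧ p) + (𝟙 (xz ∧ zy ∧ p) + (𝟙 (yx ∧ xz ∧ p)
      + (𝟙 (yz ∧ zx ∧ p) + (𝟙 (zx ∧ xy ∧ p) + 𝟙 (zy ∧ yx ∧ p))))) ≤ᵇ 𝟙 p

  -- Permuting the summation variables leaves the total unchanged, so the six arrangements of the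
  -- sorted indicator `t` sum to six times the count; pointwise they sum to at most `𝟙 (P x y z)`.
  6*count3≤∑³ : (P : Fin n → Fin n → Fin n → Bool) →
                (∀ x y z → P x y z ≡ P y x z) → (∀ x y z → P x y z ≡ P x z y) →
                6 * count3 P ≤ ∑³ (λ x y z → 𝟙 (P x y z))
  6*count3≤∑³ P s₁₂ s₂₃ = ≤-trans (≤-reflexive (sym total)) (∑³-mono pointwise)
    where
    t : Fin n → Fin n → Fin n → ℕ
    t x y z = 𝟙 (⌊ x <? y ⌋ ∧ ⌊ y <? z ⌋ ∧ P x y z)
    f : Fin n → Fin n → Fin n → ℕ
    f x y z = t x y z + (t x z y + (t y x z + (t y z x + (t z x y + t z y x))))
    pointwise : ∀ x y z → f x y z ≤ 𝟙 (P x y z)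
    pointwise x y z
      -- Symmetry replaces `P` on the five other arrangements by `P x y z`.
      rewrite sym (s₂₃ x y z) | sym (s₁₂ x y z)
            | sym (trans (s₁₂ x y z) (s₂₃ y x z))
            | sym (trans (s₂₃ x y z) (s₁₂ x z y))
            | sym (trans (trans (s₁₂ x y z) (s₂₃ y x z)) (s₁₂ y z x))
      = sortedOnce (P x y z) x y z
    sixfold : ∀ s → s + (s + (s + (s + (s + s)))) ≡ 6 * s
    sixfold = solve-∀
    split : ∀ g h {s} → ∑³ g ≡ ∑³ t → ∑³ h ≡ s →
            ∑³ (λ x y z → g x y z + h x y z) ≡ ∑³ t + s
    split g h p q = trans (∑³-+ g h) (cong₂ _+_ p q)
    total : ∑³ f ≡ 6 * count3 P
    total = trans
      (split t _ refl
      (split (λ x y z → t x z y) _ (∑³-swap₂₃ t)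
      (split (λ x y z → t y x z) _ (∑³-swap₁₂ t)
      (split (λ x y z → t y z x) _
        (trans (∑³-swap₁₂ (λ x y z → t x z y)) (∑³-swap₂₃ t))
      (split (λ x y z → t z x y) (λ x y z → t z y x)
        (trans (∑³-swap₂₃ (λ x y z → t y x z)) (∑³-swap₁₂ t))
        (trans (∑³-swap₁₂ (λ x y z → t z x y))
          (trans (∑³-swap₂₃ (λ x y z → t y x z)) (∑³-swap₁₂ t))))))))
      (sixfold (∑³ t))

-- Weights of five vertices

isEdge : ∀ {n} → Label n → Bool
isEdge none    = false
isEdge undir   = true
isEdge (dir _) = true

T-isEdge : ∀ {n} {l : Label n} → T (isEdge l) → l ≢ none
T-isEdge () refl

weight : ∀ {n} → Label n → ℕ
weight l = 3 * 𝟙 (isUndir l) + 5 * 𝟙 (isDir l)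

-- For a directed edge and a fourth vertex u, the arguments tell whether
-- {tail₁,tail₂,u}, {tail₁,head,u} and {tail₂,head,u} are edges.
compatible : Bool → Bool → Bool → Bool
compatible p q r = not (p ∧ (q ∨ r))

compatible-intro : ∀ {p q r} → (T p → T q → ⊥) → (T p → T r → ⊥) → T (compatible p q r)
compatible-intro {false}                f g = tt
compatible-intro {true} {true}          f g = f tt tt
compatible-intro {true} {false} {true}  f g = g tt tt
compatible-intro {true} {false} {false} f g = tt

-- The edge {x,y,z} (if e) can be directed only if some choice of head is compatible
-- with both remaining vertices u, v; here p, q, r stand for xyu, xzu, yzu, and
-- p′, q′, r′ for xyv, xzv, yzv.
maxWeight : (e p q r p′ q′ r′ : Bool) → ℕ
maxWeight e p q r p′ q′ r′ =
  if e then (if (compatible p q r ∧ compatible p′ q′ r′)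
              ∨ (compatible q p r ∧ compatible q′ p′ r′)
              ∨ (compatible r p q ∧ compatible r′ p′ q′) then 5 else 3)
       else 0

-- Only the underlying 3-graph enters: `maxWeight` lets each edge pick its head independently of the
-- others, so 2^10 edge patterns suffice. The pattern with all ten edges attains 30.
fivePointBound : ∀ abc abd abe acd ace ade bcd bce bde cde →
  maxWeight abc abd acd bcd abe ace bce + (maxWeight abd abc acd bcd abe ade bde +
  (maxWeight abe abc ace bce abd ade bde + (maxWeight acd abc abd bcd ace ade cde +
  (maxWeight ace abc abe bce acd ade cde + (maxWeight ade abd abe bde acd ace cde +
  (maxWeight bcd abc abd acd bce bde cde + (maxWeight bce abc abe ace bcd bde cde +
  (maxWeight bde abd abe ade bcd bce cde + maxWeight cde acd ace ade bcd bce bde))))))))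
  ≤ 30
fivePointBound abc abd abe acd ace ade bcd bce bde cde = ≤ᵇ⇒≤ _ 30
  (allAssignments-sound 10
    (λ { (abc ∷ abd ∷ abe ∷ acd ∷ ace ∷ ade ∷ bcd ∷ bce ∷ bde ∷ cde ∷ []) →
      maxWeight abc abd acd bcd abe ace bce + (maxWeight abd abc acd bcd abe ade bde +
      (maxWeight abe abc ace bce abd ade bde + (maxWeight acd abc abd bcd ace ade cde +
      (maxWeight ace abc abe bce acd ade cde + (maxWeight ade abd abe bde acd ace cde +
      (maxWeight bcd abc abd acd bce bde cde + (maxWeight bce abc abe ace bcd bde cde +
      (maxWeight bde abd abe ade bcd bce cde + maxWeight cde acd ace ade bcd bce bde))))))))
      ≤ᵇ 30 }) tt
    (abc ∷ abd ∷ abe ∷ acd ∷ ace ∷ ade ∷ bcd ∷ bce ∷ bde ∷ cde ∷ []))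

-- Directed edges in a T⃗₃-free 3-PDG.

module _ {n : ℕ} (H : PDG n) where

  rotate : ∀ x y z → edge H y z x ≡ edge H x y z
  rotate x y z = trans (swap₂₃ H y z x) (swap₁₂ H y x z)

  distinct₁₂ : ∀ {x y z} → edge H x y z ≢ none → x ≢ y
  distinct₁₂ e refl = e (degen H _ _)

  distinct₂₃ : ∀ {x y z} → edge H x y z ≢ none → y ≢ z
  distinct₂₃ e refl = e (trans (sym (rotate _ _ _)) (degen H _ _))

  distinct₁₃ : ∀ {x y z} → edge H x y z ≢ none → x ≢ z
  distinct₁₃ e = distinct₁₂ (e ∘ trans (swap₂₃ H _ _ _))

  module _ (free : T3Free H) where

    -- Injectivity of the embedding is automatic: each pair among the four vertices lies in one of
    -- the three edges, and an edge has distinct vertices. The pair `a`, `d` is the one that needs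
    -- the directed edge.
    noT3 : ∀ {a b c d} → edge H a b c ≢ none → edge H b c d ≢ none →
           edge H a b d ≢ dir d
    noT3 {a} {b} {c} {d} abc bcd abd = free (f , injective _ _ , abc , bcd , abd)
      where
      f : Fin 4 → Fin n
      f zero                   = a
      f (suc zero)             = b
      f (suc (suc zero))       = c
      f (suc (suc (suc zero))) = d
      a≢d : a ≢ d
      a≢d = distinct₁₃ {y = b} λ eq → contradiction (trans (sym abd) eq) λ ()
      injective : ∀ i j → f i ≡ f j → i ≡ j
      injective zero zero eq = refl
      injective zero (suc zero) eq = contradiction eq (distinct₁₂ abc)
      injective zero (suc (suc zero)) eq = contradiction eq (distinct₁₃ abc)
      injective zero (suc (suc (suc zero))) eq = contradiction eq a≢d
      injective (suc zero) zero eq = contradiction (sym eq) (distinct₁₂ abc)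
      injective (suc zero) (suc zero) eq = refl
      injective (suc zero) (suc (suc zero)) eq = contradiction eq (distinct₁₂ bcd)
      injective (suc zero) (suc (suc (suc zero))) eq = contradiction eq (distinct₁₃ bcd)
      injective (suc (suc zero)) zero eq = contradiction (sym eq) (distinct₁₃ abc)
      injective (suc (suc zero)) (suc zero) eq = contradiction (sym eq) (distinct₁₂ bcd)
      injective (suc (suc zero)) (suc (suc zero)) eq = refl
      injective (suc (suc zero)) (suc (suc (suc zero))) eq = contradiction eq (distinct₂₃ bcd)
      injective (suc (suc (suc zero))) zero eq = contradiction (sym eq) a≢d
      injective (suc (suc (suc zero))) (suc zero) eq = contradiction (sym eq) (distinct₁₃ bcd)
      injective (suc (suc (suc zero))) (suc (suc zero)) eq = contradiction (sym eq) (distinct₂₃ bcd)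
      injective (suc (suc (suc zero))) (suc (suc (suc zero))) eq = refl

    E : Fin n → Fin n → Fin n → Bool
    E x y z = isEdge (edge H x y z)

    E-swap : ∀ x y z → E x z y ≡ E x y z
    E-swap x y z = cong isEdge (swap₂₃ H x z y)

    E-rotate : ∀ x y z → E y z x ≡ E x y z
    E-rotate x y z = cong isEdge (rotate x y z)

    -- The vertex `u` plays vertex 2 of T⃗₃ and the head `z` plays vertex 3, numbering from 0. The
    -- tails `x` and `y` can play 0 and 1 in either order, which gives the two excluded pairs of
    -- edges.
    directed-compatible : ∀ {x y z} → edge H x y z ≡ dir z → ∀ u →
                          T (compatible (E x y u) (E x z u) (E y z u))
    directed-compatible {x} {y} {z} xyz u = compatible-intro
      (λ xyu xzu → noT3 {y} {x} {u} {z}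
        (T-isEdge xyu ∘ trans (swap₁₂ H x y u))
        (T-isEdge xzu ∘ trans (swap₂₃ H x z u))
        (trans (swap₁₂ H y x z) xyz))
      (λ xyu yzu → noT3 {x} {y} {u} {z}
        (T-isEdge xyu) (T-isEdge yzu ∘ trans (swap₂₃ H y z u)) xyz)

    -- `fivePointBound` names each triple by its sorted list of variables. `Link` translates from
    -- `u` in last place to that form; the index in `link₁` to `link₄` is the position of `u` after
    -- insertion into the list `x`, `y`, `z`.
    Link : Fin n → Fin n → Fin n → Fin n → Bool → Bool → Bool → Set
    Link x y z u p q r = E x y u ≡ p × E x z u ≡ q × E y z u ≡ r

    link₄ : ∀ {x y z u} → Link x y z u (E x y u) (E x z u) (E y z u)
    link₄ = refl , refl , refl

    link₃ : ∀ {x y z u} → Link x y z u (E x y u) (E x u z) (E y u z)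
    link₃ = refl , E-swap _ _ _ , E-swap _ _ _

    link₂ : ∀ {x y z u} → Link x y z u (E x u y) (E x u z) (E u y z)
    link₂ = E-swap _ _ _ , E-swap _ _ _ , E-rotate _ _ _

    link₁ : ∀ {x y z u} → Link x y z u (E u x y) (E u x z) (E u y z)
    link₁ = E-rotate _ _ _ , E-rotate _ _ _ , E-rotate _ _ _

    -- A directed edge has its head among its three vertices, and that choice of head is compatible
    -- with both `u` and `v`, so the allowance is 5. An undirected edge weighs 3, which either
    -- branch allows.
    weight≤maxWeight : ∀ {x y z} u v {p q r p′ q′ r′} →
      Link x y z u p q r → Link x y z v p′ q′ r′ →
      weight (edge H x y z) ≤ maxWeight (E x y z) p q r p′ q′ r′
    weight≤maxWeight {x} {y} {z} u v (refl , refl , refl) (refl , refl , refl)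
      with edge H x y z in eq
    ... | none  = z≤n
    ... | undir = 3≤if _
      where
      3≤if : ∀ b → 3 ≤ (if b then 5 else 3)
      3≤if true  = s≤s (s≤s (s≤s z≤n))
      3≤if false = ≤-refl
    ... | dir w = 5≤if (some (dirIn H x y z w eq))
      where
      5≤if : ∀ {b} → T b → 5 ≤ (if b then 5 else 3)
      5≤if {true} _ = ≤-refl
      or₁ : ∀ a b c → T a → T (a ∨ b ∨ c)
      or₁ true _ _ _ = tt
      or₂ : ∀ a b c → T b → T (a ∨ b ∨ c)
      or₂ true  _    _ _ = tt
      or₂ false true _ _ = tt
      or₃ : ∀ a b c → T c → T (a ∨ b ∨ c)
      or₃ true  _     _    _ = tt
      or₃ false true  _    _ = tt
      or₃ false false true _ = tt
      -- The head is moved to third place by symmetry; `subst` then restores the argument order used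
      -- in `maxWeight`.
      toY : w ≡ y → ∀ u → T (compatible (E x z u) (E x y u) (E y z u))
      toY refl u = subst (λ b → T (compatible (E x z u) (E x y u) b))
        (cong isEdge (swap₁₂ H z y u))
        (directed-compatible (trans (swap₂₃ H x z y) eq) u)
      toX : w ≡ x → ∀ u → T (compatible (E y z u) (E x y u) (E x z u))
      toX refl u = subst T
        (cong₂ (compatible (E y z u))
          (cong isEdge (swap₁₂ H y x u)) (cong isEdge (swap₁₂ H z x u)))
        (directed-compatible (trans (rotate x y z) eq) u)
      headZ headY headX : Bool
      headZ = compatible (E x y u) (E x z u) (E y z u) ∧ compatible (E x y v) (E x z v) (E y z v)
      headY = compatible (E x z u) (E x y u) (E y z u) ∧ compatible (E x z v) (E x y v) (E y z v)
      headX = compatible (E y z u) (E x y u) (E x z u) ∧ compatible (E y z v) (E x y v) (E x z v)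
      some : w ≡ x ⊎ w ≡ y ⊎ w ≡ z → T (headZ ∨ headY ∨ headX)
      some (inj₁ w≡x)         = or₃ headZ headY headX (T-∧-intro (toX w≡x u) (toX w≡x v))
      some (inj₂ (inj₁ w≡y))  = or₂ headZ headY headX (T-∧-intro (toY w≡y u) (toY w≡y v))
      some (inj₂ (inj₂ refl)) =
        or₁ headZ headY headX (T-∧-intro (directed-compatible eq u) (directed-compatible eq v))

    fiveVertexWeight : ∀ a b c d e →
      triplesSum (λ x y z → weight (edge H x y z)) a b c d e ≤ 30
    fiveVertexWeight a b c d e = ≤-trans
      -- Each line treats one triple, listing the two vertices outside it and the position each
      -- takes when inserted.
      (+-mono-≤ (weight≤maxWeight d e link₄ link₄)
      (+-mono-≤ (weight≤maxWeight c e link₃ link₄)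
      (+-mono-≤ (weight≤maxWeight c d link₃ link₃)
      (+-mono-≤ (weight≤maxWeight b e link₂ link₄)
      (+-mono-≤ (weight≤maxWeight b d link₂ link₃)
      (+-mono-≤ (weight≤maxWeight b c link₂ link₂)
      (+-mono-≤ (weight≤maxWeight a e link₁ link₄)
      (+-mono-≤ (weight≤maxWeight a d link₁ link₃)
      (+-mono-≤ (weight≤maxWeight a c link₁ link₂)
                (weight≤maxWeight a b link₁ link₁))))))))))
      (fivePointBound (E a b c) (E a b d) (E a b e) (E a c d) (E a c e)
                      (E a d e) (E b c d) (E b c e) (E b d e) (E c d e))

-- Averaging

∑³-weight≤ : ∀ {m} (H : PDG (suc m)) → T3Free H →
  ∑³ (λ x y z → weight (edge H x y z)) ≤ 3 * (suc m * (suc m * suc m))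
-- Each ordered triple is counted 10 n² times among the 5-tuples. This factor is positive as `n` is
-- a successor, so it cancels and leaves 30 n⁵ / (10 n²) = 3 n³.
∑³-weight≤ {m} H free = *-cancelˡ-≤ (10 * (n * n)) (begin
  10 * (n * n) * W                       ≡⟨ lhs n W ⟩
  10 * (n * (n * 1) * W)                 ≡⟨ sym (∑⁵-triplesSum (λ x y z → weight (edge H x y z))) ⟩
  ∑⁵ (triplesSum λ x y z → weight (edge H x y z))
                                         ≤⟨ ∑⁵-mono (fiveVertexWeight H free) ⟩
  ∑⁵ {n} (λ _ _ _ _ _ → 30)              ≡⟨ ∑⁵-const {n} 30 ⟩
  n * (n * (n * (n * (n * 1)))) * 30     ≡⟨ rhs n ⟩
  10 * (n * n) * (3 * (n * (n * n)))     ∎)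
  where
  open ≤-Reasoning
  n = suc m
  W = ∑³ (λ x y z → weight (edge H x y z))
  lhs : ∀ n W → 10 * (n * n) * W ≡ 10 * (n * (n * 1) * W)
  lhs = solve-∀
  rhs : ∀ n → n * (n * (n * (n * (n * 1)))) * 30 ≡ 10 * (n * n) * (3 * (n * (n * n)))
  rhs = solve-∀

6*weight≤∑³ : ∀ {n} (H : PDG n) →
  6 * (3 * eU H + 5 * eD H) ≤ ∑³ (λ x y z → weight (edge H x y z))
6*weight≤∑³ H = begin
  6 * (3 * eU H + 5 * eD H)              ≡⟨ distribute (eU H) (eD H) ⟩
  3 * (6 * eU H) + 5 * (6 * eD H)        ≤⟨ +-mono-≤ (*-monoʳ-≤ 3 boundU) (*-monoʳ-≤ 5 boundD) ⟩
  3 * ∑³ U + 5 * ∑³ D                    ≡⟨ sym (cong₂ _+_ (∑³-* 3 U) (∑³-* 5 D)) ⟩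
  ∑³ (λ x y z → 3 * U x y z) + ∑³ (λ x y z → 5 * D x y z)
                                         ≡⟨ sym (∑³-+ (λ x y z → 3 * U x y z) (λ x y z → 5 * D x y z)) ⟩
  ∑³ (λ x y z → weight (edge H x y z))   ∎
  where
  open ≤-Reasoning
  U D : _ → _ → _ → ℕ
  U x y z = 𝟙 (isUndir (edge H x y z))
  D x y z = 𝟙 (isDir (edge H x y z))
  boundU : 6 * eU H ≤ ∑³ U
  boundU = 6*count3≤∑³ _ (λ x y z → cong isUndir (swap₁₂ H x y z))
                         (λ x y z → cong isUndir (swap₂₃ H x y z))
  boundD : 6 * eD H ≤ ∑³ D
  boundD = 6*count3≤∑³ _ (λ x y z → cong isDir (swap₁₂ H x y z))
                         (λ x y z → cong isDir (swap₂₃ H x y z))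
  distribute : ∀ u d → 6 * (3 * u + 5 * d) ≡ 3 * (6 * u) + 5 * (6 * d)
  distribute = solve-∀

-- Comparison of n³ with the binomial coefficient C(n,3).

2*C2 : ∀ m → 2 * (suc m C 2) ≡ suc m * m
2*C2 zero    = refl
2*C2 (suc m) = begin
  2 * (suc (suc m) C 2)               ≡⟨ cong (2 *_) (sym (nCk+nC[k+1]≡[n+1]C[k+1] (suc m) 1)) ⟩
  2 * (suc m C 1 + suc m C 2)         ≡⟨ *-distribˡ-+ 2 (suc m C 1) _ ⟩
  2 * (suc m C 1) + 2 * (suc m C 2)   ≡⟨ cong₂ _+_ (cong (2 *_) (nC1≡n (suc m))) (2*C2 m) ⟩
  2 * suc m + suc m * m               ≡⟨ identity m ⟩
  suc (suc m) * suc m                 ∎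
  where
  open ≡-Reasoning
  identity : ∀ m → 2 * suc m + suc m * m ≡ suc (suc m) * suc m
  identity = solve-∀

-- Writing n as `suc (suc m)` expresses n(n-1)(n-2) without truncated subtraction; the induction is
-- Pascal's rule.
6*C3 : ∀ m → 6 * (suc (suc m) C 3) ≡ suc (suc m) * (suc m * m)
6*C3 zero    = refl
6*C3 (suc m) = begin
  6 * (suc n C 3)                     ≡⟨ cong (6 *_) (sym (nCk+nC[k+1]≡[n+1]C[k+1] n 2)) ⟩
  6 * (n C 2 + n C 3)                 ≡⟨ *-distribˡ-+ 6 (n C 2) _ ⟩
  6 * (n C 2) + 6 * (n C 3)           ≡⟨ cong (_+ 6 * (n C 3)) (*-assoc 3 2 (n C 2)) ⟩
  3 * (2 * (n C 2)) + 6 * (n C 3)     ≡⟨ cong₂ _+_ (cong (3 *_) (2*C2 (suc m))) (6*C3 m) ⟩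
  3 * (n * suc m) + n * (suc m * m)   ≡⟨ identity m ⟩
  suc n * (n * suc m)                 ∎
  where
  open ≡-Reasoning
  n = suc (suc m)
  identity : ∀ m → 3 * (suc (suc m) * suc m) + suc (suc m) * (suc m * m)
                   ≡ suc (suc (suc m)) * (suc (suc m) * suc m)
  identity = solve-∀

-- With n = m + 2 and K = k + 1, the difference (K+1)(n-1)(n-2) - K n² equals n(n - 3(K+1)) +
-- 2(K+1). It is nonnegative once n ≥ 3(K+1) = 3k + 6, and `j` is the excess over this threshold.
square≤falling : ∀ k j → let m = 3 * k + 4 + j in
  suc k * (suc (suc m) * suc (suc m)) ≤ (suc k + 1) * (suc m * m)
square≤falling k j = ≤-trans (m≤m+n _ _) (≤-reflexive (sym (identity k j)))
  where
  identity : ∀ k j → let m = 3 * k + 4 + j in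
    (suc k + 1) * (suc m * m)
    ≡ suc k * (suc (suc m) * suc (suc m)) + ((3 * k + 4 + j) * j + 2 * j + (2 * k + 4))
  identity = solve-∀

-- Averaging over tuples with repetitions gives n³ in place of n(n-1)(n-2); the factor (k+2)/(k+1)
-- absorbs the loss.
upperBound : ∀ k j (H : PDG (suc (suc (3 * k + 4 + j)))) → T3Free H →
  suc k * (3 * eU H + 5 * eD H) ≤ (suc k + 1) * (3 * (suc (suc (3 * k + 4 + j)) C 3))
upperBound k j H free = *-cancelˡ-≤ 6 (begin
  6 * (suc k * w)                             ≡⟨ shuffle₁ (suc k) w ⟩
  suc k * (6 * w)                             ≤⟨ *-monoʳ-≤ (suc k) (≤-trans (6*weight≤∑³ H) (∑³-weight≤ H free)) ⟩
  suc k * (3 * (n * (n * n)))                 ≡⟨ shuffle₂ (suc k) n ⟩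
  3 * n * (suc k * (n * n))                   ≤⟨ *-monoʳ-≤ (3 * n) (square≤falling k j) ⟩
  3 * n * ((suc k + 1) * (suc m * m))         ≡⟨ shuffle₃ (suc k + 1) n (suc m * m) ⟩
  (suc k + 1) * (3 * (n * (suc m * m)))       ≡⟨ cong (λ t → (suc k + 1) * (3 * t)) (sym (6*C3 m)) ⟩
  (suc k + 1) * (3 * (6 * (n C 3)))           ≡⟨ shuffle₄ (suc k + 1) (n C 3) ⟩
  6 * ((suc k + 1) * (3 * (n C 3)))           ∎)
  where
  open ≤-Reasoning
  m = 3 * k + 4 + j
  n = suc (suc m)
  w = 3 * eU H + 5 * eD H
  shuffle₁ : ∀ a w → 6 * (a * w) ≡ a * (6 * w)
  shuffle₁ = solve-∀
  shuffle₂ : ∀ a n → a * (3 * (n * (n * n))) ≡ 3 * n * (a * (n * n))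
  shuffle₂ = solve-∀
  shuffle₃ : ∀ a n t → 3 * n * (a * t) ≡ a * (3 * (n * t))
  shuffle₃ = solve-∀
  shuffle₄ : ∀ a c → a * (3 * (6 * c)) ≡ 6 * (a * (3 * c))
  shuffle₄ = solve-∀

-- The complete undirected 3-graph

∑-suc : ∀ {n} (f : Fin (suc n) → ℕ) → ∑ f ≡ f zero + ∑ (f ∘ suc)
∑-suc f = cong (λ xs → f zero + sum xs)
  (trans (map-tabulate suc f) (sym (map-tabulate (λ x → x) (f ∘ suc))))

∑-zero : ∀ n → ∑ {n} (λ _ → 0) ≡ 0
∑-zero n = trans (multiple⁻¹ (drop {n} (unit {n} {0}))) (*-zeroʳ (n * 1))

-- Data.Fin's _<?_ compares across different Fin m and Fin n.
_<ᵇᶠ_ : ∀ {n} → Fin n → Fin n → Bool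
x <ᵇᶠ y = ⌊ x <? y ⌋

-- The proof passes through `does`, where the two comparisons agree by computation.
suc<ᵇᶠsuc : ∀ {n} (x y : Fin n) → (suc x <ᵇᶠ suc y) ≡ (x <ᵇᶠ y)
suc<ᵇᶠsuc x y = trans (isYes≗does (suc x <? suc y)) (sym (isYes≗does (x <? y)))

-- Splitting by whether the smaller entry is `zero` reproduces Pascal's rule; `increasingTriples`
-- does the same with the least of three entries.
increasingPairs : ∀ n → ∑ {n} (λ x → ∑ λ y → 𝟙 (x <ᵇᶠ y)) ≡ n C 2
increasingPairs zero    = refl
increasingPairs (suc n) = begin
  ∑ {suc n} (λ x → ∑ λ y → 𝟙 (x <ᵇᶠ y))
    ≡⟨ ∑-suc {n} (λ x → ∑ λ y → 𝟙 (x <ᵇᶠ y)) ⟩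
  ∑ {suc n} (λ y → 𝟙 (zero <ᵇᶠ y)) + ∑ {n} (λ x → ∑ λ y → 𝟙 (suc x <ᵇᶠ y))
    ≡⟨ cong₂ _+_ (∑-suc {n} λ y → 𝟙 (zero <ᵇᶠ y)) (∑-cong noMinimum) ⟩
  ∑ {n} (λ _ → 1) + ∑ {n} (λ x → ∑ λ y → 𝟙 (x <ᵇᶠ y))
    ≡⟨ cong₂ _+_ ones (increasingPairs n) ⟩
  n C 1 + n C 2
    ≡⟨ nCk+nC[k+1]≡[n+1]C[k+1] n 1 ⟩
  suc n C 2 ∎
  where
  open ≡-Reasoning
  noMinimum : ∀ (x : Fin n) → ∑ (λ y → 𝟙 (suc x <ᵇᶠ y)) ≡ ∑ (λ y → 𝟙 (x <ᵇᶠ y))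
  noMinimum x = trans (∑-suc λ y → 𝟙 (suc x <ᵇᶠ y)) (∑-cong λ y → cong 𝟙 (suc<ᵇᶠsuc x y))
  ones : ∑ {n} (λ _ → 1) ≡ n C 1
  ones = trans (multiple⁻¹ (drop {n} (unit {n} {1})))
    (trans (*-identityʳ (n * 1)) (trans (*-identityʳ n) (sym (nC1≡n n))))

increasingTriples : ∀ n → ∑³ {n} (λ x y z → 𝟙 ((x <ᵇᶠ y) ∧ (y <ᵇᶠ z))) ≡ n C 3
increasingTriples zero    = refl
increasingTriples (suc n) = begin
  ∑³ {suc n} t
    ≡⟨ ∑-suc (λ x → ∑ λ y → ∑ λ z → t x y z) ⟩
  ∑ (λ y → ∑ λ z → t zero y z) + ∑ (λ x → ∑ λ y → ∑ λ z → t (suc x) y z)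
    ≡⟨ cong₂ _+_ minimum (∑-cong noMinimum) ⟩
  ∑ {n} (λ y → ∑ λ z → 𝟙 (y <ᵇᶠ z)) + ∑³ {n} (λ x y z → 𝟙 ((x <ᵇᶠ y) ∧ (y <ᵇᶠ z)))
    ≡⟨ cong₂ _+_ (increasingPairs n) (increasingTriples n) ⟩
  n C 2 + n C 3
    ≡⟨ nCk+nC[k+1]≡[n+1]C[k+1] n 2 ⟩
  suc n C 3 ∎
  where
  open ≡-Reasoning
  t : Fin (suc n) → Fin (suc n) → Fin (suc n) → ℕ
  t x y z = 𝟙 ((x <ᵇᶠ y) ∧ (y <ᵇᶠ z))
  minimum : ∑ (λ y → ∑ λ z → t zero y z) ≡ ∑ {n} (λ y → ∑ λ z → 𝟙 (y <ᵇᶠ z))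
  minimum = trans (∑-suc λ y → ∑ λ z → t zero y z)
    (cong₂ _+_ (∑-zero (suc n))
      (∑-cong λ y → trans (∑-suc λ z → t zero (suc y) z)
        (∑-cong λ z → cong 𝟙 (suc<ᵇᶠsuc y z))))
  noMinimum : ∀ x → ∑ (λ y → ∑ λ z → t (suc x) y z)
                    ≡ ∑ {n} (λ y → ∑ λ z → 𝟙 ((x <ᵇᶠ y) ∧ (y <ᵇᶠ z)))
  -- Terms with `y` or `z` equal to `zero` vanish, since `zero` exceeds no vertex.
  noMinimum x = trans (∑-suc λ y → ∑ λ z → t (suc x) y z)
    (cong₂ _+_ (∑-zero (suc n))
      (∑-cong λ y → trans (∑-suc λ z → t (suc x) (suc y) z)
        (cong₂ _+_ (cong 𝟙 (∧-zeroʳ (suc x <ᵇᶠ suc y)))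
          (∑-cong λ z → cong 𝟙 (cong₂ _∧_ (suc<ᵇᶠsuc x y) (suc<ᵇᶠsuc y z))))))

-- Deciding whether a triple is degenerate as one proposition makes the symmetry
-- laws instances of does-⇔.
Repeated : ∀ {n} → Fin n → Fin n → Fin n → Set
Repeated x y z = x ≡ y ⊎ y ≡ z ⊎ x ≡ z

repeated? : ∀ {n} (x y z : Fin n) → Dec (Repeated x y z)
repeated? x y z = (x ≟ y) ⊎-dec (y ≟ z) ⊎-dec (x ≟ z)

label : ∀ {n} → Bool → Label n
label b = if b then none else undir

label≢dir : ∀ {n} b {v : Fin n} → label b ≢ dir v
label≢dir true  ()
label≢dir false ()

complete : ∀ n → PDG n
complete n = record
  { edge   = λ x y z → label (does (repeated? x y z))
  ; swap₁₂ = λ x y z → cong label (does-⇔ (mk⇔ flip₁₂ flip₁₂) (repeated? x y z) (repeated? y x z))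
  ; swap₂₃ = λ x y z → cong label (does-⇔ (mk⇔ flip₂₃ flip₂₃) (repeated? x y z) (repeated? x z y))
  ; degen  = λ x z → cong label (dec-true (repeated? x x z) (inj₁ refl))
  ; dirIn  = λ x y z v eq → ⊥-elim (label≢dir (does (repeated? x y z)) eq)
  }
  where
  flip₁₂ : ∀ {x y z : Fin n} → Repeated x y z → Repeated y x z
  flip₁₂ (inj₁ x≡y)        = inj₁ (sym x≡y)
  flip₁₂ (inj₂ (inj₁ y≡z)) = inj₂ (inj₂ y≡z)
  flip₁₂ (inj₂ (inj₂ x≡z)) = inj₂ (inj₁ x≡z)
  flip₂₃ : ∀ {x y z : Fin n} → Repeated x y z → Repeated x z y
  flip₂₃ (inj₁ x≡y)        = inj₂ (inj₂ x≡y)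
  flip₂₃ (inj₂ (inj₁ y≡z)) = inj₂ (inj₁ (sym y≡z))
  flip₂₃ (inj₂ (inj₂ x≡z)) = inj₁ x≡z

-- A copy of T⃗₃ needs a directed edge, and `complete n` has none.
complete-T3Free : ∀ n → T3Free (complete n)
complete-T3Free n (f , _ , _ , _ , eq) =
  label≢dir (does (repeated? (f zero) (f (suc zero)) (f (suc (suc (suc zero)))))) eq

C3≤eU-complete : ∀ n → n C 3 ≤ eU (complete n)
C3≤eU-complete n = subst (_≤ eU (complete n)) (increasingTriples n) (∑³-mono pointwise)
  where
  pointwise : ∀ (x y z : Fin n) → 𝟙 (⌊ x <? y ⌋ ∧ ⌊ y <? z ⌋)
    ≤ 𝟙 (⌊ x <? y ⌋ ∧ ⌊ y <? z ⌋ ∧ isUndir (edge (complete n) x y z))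
  pointwise x y z with x <? y | y <? z
  ... | no _    | _       = z≤n
  ... | yes _   | no _    = z≤n
  ... | yes x<y | yes y<z = ≤-reflexive (sym (cong (λ b → 𝟙 (isUndir (label {n} b)))
    (dec-false (repeated? x y z) λ where
      (inj₁ x≡y)        → Fin.<⇒≢ x<y x≡y
      (inj₂ (inj₁ y≡z)) → Fin.<⇒≢ y<z y≡z
      (inj₂ (inj₂ x≡z)) → Fin.<⇒≢ (Fin.<-trans x<y y<z) x≡z)))

-- Multiplying α + (5/3)β by 3 C(n,3) clears denominators. The first half says that it is at most 1
-- + 1/(k+1) for all large n, the second that it reaches 1 - 1/(k+1) for arbitrarily large n;
-- together they determine the limit value 1.
theorem2p3 : ((k : ℕ) → Σ ℕ λ N → (n : ℕ) → N ≤ n → (H : PDG n) → T3Free H →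
    suc k * (3 * eU H + 5 * eD H) ≤ (suc k + 1) * (3 * (n C 3)))
    ×
    ((k N : ℕ) → Σ ℕ λ n → N ≤ n × Σ (PDG n) λ H → T3Free H ×
    k * (3 * (n C 3)) ≤ suc k * (3 * eU H + 5 * eD H))
theorem2p3 = upper , lower
  where
  upper : (k : ℕ) → Σ ℕ λ N → (n : ℕ) → N ≤ n → (H : PDG n) → T3Free H →
    suc k * (3 * eU H + 5 * eD H) ≤ (suc k + 1) * (3 * (n C 3))
  -- The threshold is 3(k+2), from `square≤falling`.
  upper k = suc (suc (3 * k + 4)) , λ n N≤n → bound (m≤n⇒∃[o]m+o≡n N≤n)
    where
    bound : ∀ {n} → (Σ ℕ λ j → suc (suc (3 * k + 4)) + j ≡ n) → (H : PDG n) → T3Free H →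
      suc k * (3 * eU H + 5 * eD H) ≤ (suc k + 1) * (3 * (n C 3))
    bound (j , refl) = upperBound k j
  lower : (k N : ℕ) → Σ ℕ λ n → N ≤ n × Σ (PDG n) λ H → T3Free H ×
    k * (3 * (n C 3)) ≤ suc k * (3 * eU H + 5 * eD H)
  lower k N = N , ≤-refl , complete N , complete-T3Free N ,
    *-mono-≤ (n≤1+n k) (≤-trans (*-monoʳ-≤ 3 (C3≤eU-complete N)) (m≤m+n _ _))
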